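{- Let $\mathcal{S}=\langle\mathcal{L},\vdash\rangle$ be a logic and $\alpha,\beta\in\mathcal{L}$. (1) (Quasi double negation) For every quasi-negation $\sim\!\alpha$ of $\alpha$, $\alpha$ is a quasi-negation of $\sim\!\alpha$; i.e. $\alpha\in QN(\sim\!\alpha)$. (2) (Quasi contraposition) $\alpha\in QN(\beta)$ if and only if $\beta\in QN(\alpha)$. (3) If $\langle\mathcal{L},\vdash\rangle$ is Tarskian and $\{\alpha\}\vdash\beta$, then any quasi-negation of $\beta$ is a quasi-negation of $\alpha$; i.e. $QN(\beta)\subseteq QN(\alpha)$.
   Context: A logic is a pair $\langle\mathcal{L},\vdash\rangle$ where $\mathcal{L}$ is a set (of formulas) and $\vdash\,\subseteq\mathcal{P}(\mathcal{L})\times\mathcal{L}$ is a relation (not assumed to be Tarskian here unless stated). For $\Gamma\subseteq\mathcal{L}$, $C_\vdash(\Gamma)=\{\gamma\in\mathcal{L}\mid\Gamma\vdash\gamma\}$. The logic is Tarskian if it satisfies: reflexivity ($\alpha\in\Gamma$ implies $\Gamma\vdash\alpha$), monotonicity ($\Gamma\vdash\alpha$ and $\Gamma\subseteq\Sigma$ imply $\Sigma\vdash\alpha$), and transitivity (if $\Gamma\vdash\beta$ for all $\beta\in\Delta$ and $\Delta\vdash\gamma$, then $\Gamma\vdash\gamma$). For $\alpha\in\mathcal{L}$, a quasi-negation of $\alpha$ is any $\beta\in\mathcal{L}$ such that $C_\vdash(\{\alpha,\beta\})=\mathcal{L}$. A quasi-negation of $\alpha$ (which need not exist or be unique) is denoted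 $\sim\!\alpha$, and $QN(\alpha)$ denotes the set of all quasi-negations of $\alpha$. -}

module Defs where

open import Level using (Level; _⊔_) renaming (suc to lsuc)
open import Relation.Unary using (Pred; _∈_; _⊆_; _≐_; _∪_; ｛_｝; U)

-- Sets of formulas are predicates `Pred 𝓛 a`, and equality of sets is mutual
-- inclusion `_≐_`.  As predicates with the same members need not be
-- propositionally equal, `⊢-resp-≐` is what makes `_⊢_` a relation on 𝒫(𝓛) × 𝓛.
-- It is the only law imposed: in particular, no monotonicity is assumed.
record Logic (a ℓ : Level) : Set (lsuc (a ⊔ ℓ)) where
  infix 4 _⊢_
  field
    𝓛        : Set a
    _⊢_      : Pred 𝓛 a → 𝓛 → Set ℓ
    ⊢-resp-≐ : ∀ {Γ Δ α} → Γ ≐ Δ → Γ ⊢ α → Δ ⊢ α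

  C⊢ : Pred 𝓛 a → Pred 𝓛 ℓ
  C⊢ Γ = λ γ → Γ ⊢ γ

  record Tarskian : Set (lsuc a ⊔ ℓ) where
    field
      reflexivity  : ∀ {Γ α} → α ∈ Γ → Γ ⊢ α
      monotonicity : ∀ {Γ Δ α} → Γ ⊢ α → Γ ⊆ Δ → Δ ⊢ α
      transitivity : ∀ {Γ Δ γ} → (∀ {β} → β ∈ Δ → Γ ⊢ β) → Δ ⊢ γ → Γ ⊢ γ

  QN : 𝓛 → Pred 𝓛 (a ⊔ ℓ)
  QN α = λ β → C⊢ (｛ α ｝ ∪ ｛ β ｝) ≐ U

{-# OPTIONS --safe #-}
module Submission where

open import Defs
open import Data.Product using (_×_; _,_)
open import Data.Sum using (inj₁; inj₂; swap)
open import Function.Bundles using (_⇔_; mk⇔)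
open import Relation.Binary.PropositionalEquality using (refl)
open import Relation.Unary using (_∈_; _⊆_; ｛_｝)

-- Quasi-negation is symmetric since an unordered pair explodes or not as a set; this alone gives
-- the first two claims. The third is a cut: with `α` in place of `β`, the exploding pair is still
-- derivable.

module _ {a ℓ} (S : Logic a ℓ) where
  open Logic S

  QN-sym : ∀ {α β} → β ∈ QN α → α ∈ QN β
  -- Inclusion in `U` is trivial, so only explosion needs an argument.
  QN-sym (_ , explode) = _ , λ _ → ⊢-resp-≐ (swap , swap) (explode _)

  QN-antitone : Tarskian → ∀ {α β} → ｛ α ｝ ⊢ β → QN β ⊆ QN α
  QN-antitone tarskian α⊢β (_ , explode) = _ , λ _ →
    transitivity
      -- `β` follows from `α`; its quasi-negation is itself a premise.
      (λ { (inj₁ refl) → monotonicity α⊢β inj₁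
         ; (inj₂ refl) → reflexivity (inj₂ refl) })
      (explode _)
    where open Tarskian tarskian

theorem2p17 : ∀ {a ℓ} (S : Logic a ℓ) → let open Logic S in
    (α β : 𝓛) →
    (∀ ∼α → ∼α ∈ QN α → α ∈ QN ∼α)
    × (α ∈ QN β ⇔ β ∈ QN α)
    × (Tarskian → ｛ α ｝ ⊢ β → QN β ⊆ QN α)
theorem2p17 S α β =
    (λ _ → QN-sym S)
  , mk⇔ (QN-sym S) (QN-sym S)
  , λ tarskian → QN-antitone S tarskian
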